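{- Let $i\ge 2$ be an integer and $k=2^i-1$. Let $k^-$ denote the least positive integer congruent to $-k$ modulo $i$. Then $$a_k\le 2^{k+k^- }+2^k-2^{k-i}-1.$$ If moreover $k=2^i-1$ is prime, then equality holds, i.e. $a_k=2^{k+i-1}+2^k-2^{k-i}-1$ (here $k^-=i-1$). Consequently, if there are infinitely many Mersenne primes, then $c_k/2^k\to 1/2$ as $k\to\infty$ through Mersenne primes.
   Context: For a positive integer $k$, $a_k$ is the smallest positive multiple of $k$ whose sum of binary digits equals $k$, and $c_k=a_k/k$. -}

module Defs where

open import Data.Fin.Base using (toℕ; fromℕ<)
  renaming (zero to fzero; suc to fsuc)
open import Data.Fin.Properties using (pigeonhole; fromℕ<-injective)
open import Data.Digit using (0b; 1b; Expansion; fromDigits; toDigits)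
open import Data.Integer.Base as ℤ using (ℤ; +_)
open import Data.Integer.Divisibility as ℤ using ()
import Data.Integer.Properties as ℤ
open import Data.List.Base using ([]; _∷_; _++_; map; replicate)
open import Data.Nat.ListAction using (sum)
open import Data.Nat.Base
open import Data.Nat.Divisibility
open import Data.Nat.DivMod using (m%n<n; m≡m%n+[m/n]*n)
open import Data.Nat.Induction using (<-wellFounded; Acc; acc)
open import Data.Nat.Primality using (Prime)
open import Data.Nat.Properties
open import Data.Nat.Tactic.RingSolver using (solve-∀)
open import Data.Product.Base using (∃; _×_; _,_; proj₁; proj₂)
open import Data.Rational.Base as ℚ using (ℚ; 0ℚ)
open import Level using (0ℓ)
open import Relation.Binary.PropositionalEquality
open import Relation.Nullary using (yes; no)
open import Relation.Nullary.Decidable using (_×-dec_)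
open import Relation.Unary using (Pred; Decidable)

IsLeast : Pred ℕ 0ℓ → ℕ → Set
IsLeast P m = P m × (∀ n → P n → m ≤ n)

module _ {P : Pred ℕ 0ℓ} (P? : Decidable P) where

  least-acc : ∀ m → Acc _<_ m → P m → ∃ (IsLeast P)
  least-acc m (acc rs) pm with anyUpTo? P? m
  ... | yes (n , n<m , pn) = least-acc n (rs n<m) pn
  ... | no ∄n = m , pm , λ n pn → ≮⇒≥ λ n<m → ∄n (n , n<m , pn)

  least : ∃ P → ∃ (IsLeast P)
  least (m , pm) = least-acc m (<-wellFounded m) pm

expansionSum : Expansion 2 → ℕ
expansionSum ds = sum (map toℕ ds)

s₂ : ℕ → ℕ
s₂ n = expansionSum (proj₁ (toDigits 2 n))

private

  2m≢1+2n : ∀ m n → m * 2 ≢ suc (n * 2)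
  2m≢1+2n zero    n       ()
  2m≢1+2n (suc m) zero    ()
  2m≢1+2n (suc m) (suc n) eq = 2m≢1+2n m n (suc-injective (suc-injective eq))

  half : ∀ m n → m * 2 ≡ n * 2 → m ≡ n
  half m n = *-cancelʳ-≡ m n 2

-- Expansions of the same number differ only in leading zeros, so s₂ can be
-- computed from any of them.
expansionSum-unique : ∀ ds es → fromDigits ds ≡ fromDigits es →
                      expansionSum ds ≡ expansionSum es
expansionSum-unique [] [] eq = refl
expansionSum-unique [] (fzero ∷ es) eq =
  expansionSum-unique [] es (half 0 (fromDigits es) eq)
expansionSum-unique [] (fsuc fzero ∷ es) ()
expansionSum-unique (fzero ∷ ds) [] eq =
  expansionSum-unique ds [] (half (fromDigits ds) 0 eq)
expansionSum-unique (fsuc fzero ∷ ds) [] ()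
expansionSum-unique (fzero ∷ ds) (fzero ∷ es) eq =
  expansionSum-unique ds es (half (fromDigits ds) (fromDigits es) eq)
expansionSum-unique (fzero ∷ ds) (fsuc fzero ∷ es) eq
  with () ← 2m≢1+2n (fromDigits ds) (fromDigits es) eq
expansionSum-unique (fsuc fzero ∷ ds) (fzero ∷ es) eq
  with () ← 2m≢1+2n (fromDigits es) (fromDigits ds) (sym eq)
expansionSum-unique (fsuc fzero ∷ ds) (fsuc fzero ∷ es) eq =
  cong suc (expansionSum-unique ds es
    (half (fromDigits ds) (fromDigits es) (suc-injective eq)))

s₂-fromDigits : ∀ ds → s₂ (fromDigits ds) ≡ expansionSum ds
s₂-fromDigits ds = expansionSum-unique (proj₁ ds′) ds (proj₂ ds′)
  where ds′ = toDigits 2 (fromDigits ds)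

Candidate : ℕ → Pred ℕ 0ℓ
Candidate k m = 0 < m × k ∣ m × s₂ m ≡ k

candidate? : ∀ k → Decidable (Candidate k)
candidate? k m = (0 <? m) ×-dec (k ∣? m) ×-dec (s₂ m ≟ k)

-- Two powers 2^x and 2^(x+t) with t > 0 agree modulo k, so
-- 2^x (1 + 2^t + ⋯ + 2^((k-1)t)) is a multiple of k with digit sum k.
private

  shift : ℕ → Expansion 2 → Expansion 2
  shift m ds = replicate m 0b ++ ds

  fromDigits-shift : ∀ m ds → fromDigits (shift m ds) ≡ 2 ^ m * fromDigits ds
  fromDigits-shift zero    ds = sym (*-identityˡ _)
  fromDigits-shift (suc m) ds = trans
    (cong (_* 2) (fromDigits-shift m ds)) (lem (2 ^ m) (fromDigits ds))
    where
    lem : ∀ p q → p * q * 2 ≡ 2 * p * q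
    lem = solve-∀

  expansionSum-shift : ∀ m ds → expansionSum (shift m ds) ≡ expansionSum ds
  expansionSum-shift zero    ds = refl
  expansionSum-shift (suc m) ds = expansionSum-shift m ds

  -- binary expansion of 1 + 2^(1+t) + ⋯ + 2^((n-1)(1+t))
  geometric : ℕ → ℕ → Expansion 2
  geometric t zero    = []
  geometric t (suc n) = 1b ∷ shift t (geometric t n)

  expansionSum-geometric : ∀ t n → expansionSum (geometric t n) ≡ n
  expansionSum-geometric t zero    = refl
  expansionSum-geometric t (suc n) = cong suc
    (trans (expansionSum-shift t (geometric t n)) (expansionSum-geometric t n))

  geometric-mod : ∀ k p t q → p * 2 ^ suc t ≡ p + q * k → ∀ n →
                  ∃ λ r → p * fromDigits (geometric t n) ≡ n * p + r * k
  geometric-mod k p t q eq zero = 0 , *-zeroʳ p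
  geometric-mod k p t q eq (suc n) with geometric-mod k p t q eq n
  ... | r , ih = r + q * g , (begin
    p * suc (fromDigits (shift t (geometric t n)) * 2)
      ≡⟨ cong (λ v → p * suc (v * 2)) (fromDigits-shift t (geometric t n)) ⟩
    p * suc (2 ^ t * g * 2)            ≡⟨ lem₁ p (2 ^ t) g ⟩
    p + p * 2 ^ suc t * g              ≡⟨ cong (λ v → p + v * g) eq ⟩
    p + (p + q * k) * g                ≡⟨ lem₂ p q k g ⟩
    p + (p * g + q * g * k)            ≡⟨ cong (λ v → p + (v + q * g * k)) ih ⟩
    p + (n * p + r * k + q * g * k)    ≡⟨ lem₃ p (n * p) r k (q * g) ⟩
    suc n * p + (r + q * g) * k        ∎)
    where
    open ≡-Reasoning
    g = fromDigits (geometric t n)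
    lem₁ : ∀ p u g → p * (1 + u * g * 2) ≡ p + p * (2 * u) * g
    lem₁ = solve-∀
    lem₂ : ∀ p q k g → p + (p + q * k) * g ≡ p + (p * g + q * g * k)
    lem₂ = solve-∀
    lem₃ : ∀ p u r k w → p + (u + r * k + w * k) ≡ (p + u) + (r + w) * k
    lem₃ = solve-∀

  2^-cycle : ∀ k .{{_ : NonZero k}} →
             ∃ λ x → ∃ λ t → ∃ λ q → 2 ^ x * 2 ^ suc t ≡ 2 ^ x + q * k
  2^-cycle k with pigeonhole (n<1+n k) (λ j → fromℕ< (m%n<n (2 ^ toℕ j) k))
  ... | i , j , i<j , eq = x , t , 2 ^ y / k ∸ 2 ^ x / k , (begin
    2 ^ x * 2 ^ suc t                           ≡⟨ ^-distribˡ-+-* 2 x (suc t) ⟨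
    2 ^ (x + suc t)                             ≡⟨ cong (2 ^_) y≡ ⟩
    2 ^ y                                       ≡⟨ m≡m%n+[m/n]*n (2 ^ y) k ⟩
    2 ^ y % k + 2 ^ y / k * k                   ≡⟨ cong₂ _+_ (sym eq′)
      (cong (_* k) (sym (m+[n∸m]≡n x/≤y/))) ⟩
    2 ^ x % k + (2 ^ x / k + d) * k             ≡⟨ lem (2 ^ x % k) (2 ^ x / k) d k ⟩
    (2 ^ x % k + 2 ^ x / k * k) + d * k         ≡⟨ cong (_+ d * k) (m≡m%n+[m/n]*n (2 ^ x) k) ⟨
    2 ^ x + d * k                               ∎)
    where
    open ≡-Reasoning
    open import Data.Nat.DivMod using (/-monoˡ-≤)
    x = toℕ i
    y = toℕ j
    t = y ∸ suc x
    d = 2 ^ y / k ∸ 2 ^ x / k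
    y≡ : x + suc t ≡ y
    y≡ = trans (+-suc x t) (m+[n∸m]≡n i<j)
    eq′ : 2 ^ x % k ≡ 2 ^ y % k
    eq′ = fromℕ<-injective _ _ (m%n<n (2 ^ x) k) (m%n<n (2 ^ y) k) eq
    x/≤y/ : 2 ^ x / k ≤ 2 ^ y / k
    x/≤y/ = /-monoˡ-≤ k (^-monoʳ-≤ 2 (<⇒≤ i<j))
    lem : ∀ r u d k → r + (u + d) * k ≡ (r + u * k) + d * k
    lem = solve-∀

candidate-exists : ∀ k .{{_ : NonZero k}} → ∃ (Candidate k)
candidate-exists k with 2^-cycle k
... | x , t , q , cyc with geometric-mod k (2 ^ x) t q cyc k
... | r , eq = m , n≢0⇒n>0 m≢0 , divides (2 ^ x + r) m≡ , s₂m≡k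
  where
  ds = shift x (geometric t k)
  m = fromDigits ds
  s₂m≡k : s₂ m ≡ k
  s₂m≡k = trans (s₂-fromDigits ds)
    (trans (expansionSum-shift x (geometric t k)) (expansionSum-geometric t k))
  m≢0 : m ≢ 0
  m≢0 m≡0 = ≢-nonZero⁻¹ k (trans (sym s₂m≡k) (cong s₂ m≡0))
  m≡ : m ≡ (2 ^ x + r) * k
  m≡ = begin
    m                                    ≡⟨ fromDigits-shift x (geometric t k) ⟩
    2 ^ x * fromDigits (geometric t k)   ≡⟨ eq ⟩
    k * 2 ^ x + r * k                    ≡⟨ cong (_+ r * k) (*-comm k (2 ^ x)) ⟩
    2 ^ x * k + r * k                    ≡⟨ *-distribʳ-+ k (2 ^ x) r ⟨
    (2 ^ x + r) * k                      ∎
    where open ≡-Reasoning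

a-least : ∀ k .{{_ : NonZero k}} → ∃ (IsLeast (Candidate k))
a-least k = least (candidate? k) (candidate-exists k)

a : (k : ℕ) → .{{NonZero k}} → ℕ
a k = proj₁ (a-least k)

k∣a : ∀ k .{{_ : NonZero k}} → k ∣ a k
k∣a k with a-least k
... | _ , (_ , k∣m , _) , _ = k∣m

c : (k : ℕ) → .{{NonZero k}} → ℕ
c k = quotient (k∣a k)

infix 4 _≡_[mod_]

_≡_[mod_] : ℤ → ℤ → ℕ → Set
x ≡ y [mod n ] = (+ n) ℤ.∣ (x ℤ.- y)

NegResidue : ℕ → ℕ → Pred ℕ 0ℓ
NegResidue i k m = 0 < m × (+ m) ≡ (ℤ.- (+ k)) [mod i ]

negResidue? : ∀ i k → Decidable (NegResidue i k)
negResidue? i k m = (0 <? m) ×-dec (i ∣? ℤ.∣ (+ m) ℤ.- (ℤ.- (+ k)) ∣)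

negResidue-exists : ∀ i .{{_ : NonZero i}} k → ∃ (NegResidue i k)
negResidue-exists (suc i) k = k * i + suc i , m<n⇒0<n {i} (m≤n+m (suc i) (k * i)) ,
  divides (suc k) (trans
    (cong ℤ.∣_∣ (cong (λ z → + (k * i + suc i) ℤ.+ z) (ℤ.neg-involutive (+ k))))
    (lem k i))
  where
  lem : ∀ k i → k * i + (1 + i) + k ≡ (1 + k) * (1 + i)
  lem = solve-∀

negResidue-least : ∀ i .{{_ : NonZero i}} k → ∃ (IsLeast (NegResidue i k))
negResidue-least i k = least (negResidue? i k) (negResidue-exists i k)

negResidue : (i : ℕ) → .{{NonZero i}} → ℕ → ℕ
negResidue i k = proj₁ (negResidue-least i k)

MersennePrime : Pred ℕ 0ℓ
MersennePrime p = Prime p × ∃ λ i → p ≡ 2 ^ i ∸ 1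

c/2^ : (k : ℕ) → .{{NonZero k}} → ℚ
c/2^ k = (+ c k) ℚ./ (2 ^ k)
  where instance _ = m^n≢0 2 k

-- f k → l as k → ∞ through S.  As f and l are rational, it makes no
-- difference whether ε ranges over the rationals or the reals.
TendsToThrough : Pred ℕ 0ℓ → ((k : ℕ) → .{{NonZero k}} → ℚ) → ℚ → Set
TendsToThrough S f l =
  ∀ (ε : ℚ) → 0ℚ ℚ.< ε →
  ∃ λ N → ∀ k .{{_ : NonZero k}} → S k → N ≤ k → ℚ.∣ f k ℚ.- l ∣ ℚ.< ε

{-# OPTIONS --safe #-}
-- Put k = 2 ^ i ∸ 1.  A multiple of k stays one when its lowest i bits are
-- added to the remaining ones, and this does not increase the digit sum; hence
-- every positive multiple of k has digit sum at least i.  Complementing the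
-- bits turns the numbers of length k + i ∸ 1 and digit sum k into numbers with
-- digit sum i ∸ 1.  For k prime, Fermat's little theorem gives i ∣ k ∸ 1, so
-- the complement of a multiple of k would again be one, which is impossible.
-- A multiple below 2 ^ (k + i ∸ 1) + 2 ^ k with digit sum k is then the leading
-- bit plus all but one of the powers of two below 2 ^ k; the missing one, 2 ^ x,
-- satisfies 2 ^ x ≡ 2 mod k, i.e. x ≡ 1 mod i, and x = k ∸ i is the largest
-- such x.
module Submission where

open import Defs
open import Data.Digit using (0b; 1b; fromDigits; toDigits)
open import Data.Empty using (⊥)
open import Data.Fin.Base using () renaming (zero to fzero; suc to fsuc)
open import Data.Integer.Base as ℤ using (-[1+_])
import Data.Integer.Properties as ℤ
open import Data.List.Base using ([]; _∷_)
open import Data.Nat.Base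
open import Data.Nat.Combinatorics using (_C_; nC1≡n; nCn≡1; nCk+nC[k+1]≡[n+1]C[k+1])
open import Data.Nat.Divisibility
open import Data.Nat.DivMod using (m%n<n; m≡m%n+[m/n]*n; m<n⇒m%n≡m; [m+kn]%n≡m%n)
open import Data.Nat.Induction using (<-rec)
open import Data.Nat.InfinitelyOften using (Inf)
open import Data.Nat.Primality using (Prime; prime⇒nonTrivial; euclidsLemma)
open import Data.Nat.Properties
open import Data.Nat.Tactic.RingSolver using (solve-∀)
open import Data.Product.Base using (∃; _×_; _,_; proj₁; proj₂)
open import Data.Rational.Base as ℚ using (ℚ; ½; 0ℚ)
import Data.Rational.Properties as ℚ
open import Data.Rational.Unnormalised.Base as ℚᵘ using (mkℚᵘ)
import Data.Rational.Unnormalised.Properties as ℚᵘ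
open import Data.Sum.Base using (inj₁; inj₂)
open import Relation.Binary.PropositionalEquality
open import Relation.Nullary using (contradiction)

-- Digit sums

-- The indices use `2 * n`, the shape to which `2 ^ suc l` unfolds, so a factor of two cancels
-- against a power directly. Digit lists produce `n * 2`, hence two forms of each rule below.
data Halves : ℕ → Set where
  even : ∀ n → Halves (2 * n)
  odd  : ∀ n → Halves (suc (2 * n))

halve : ∀ n → Halves n
halve zero = even 0
halve (suc n) with halve n
... | even m = odd m
... | odd m  = subst Halves (cong suc (+-suc m (m + 0))) (even (suc m))

s₂-2* : ∀ n → s₂ (2 * n) ≡ s₂ n
s₂-2* n = trans (cong s₂ (trans (*-comm 2 n) (cong (_* 2) (sym (proj₂ d)))))
                (s₂-fromDigits (0b ∷ proj₁ d))
  where d = toDigits 2 n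

s₂-1+2* : ∀ n → s₂ (suc (2 * n)) ≡ suc (s₂ n)
s₂-1+2* n = trans (cong (λ v → s₂ (suc v)) (trans (*-comm 2 n) (cong (_* 2) (sym (proj₂ d)))))
                  (s₂-fromDigits (1b ∷ proj₁ d))
  where d = toDigits 2 n

s₂-*2 : ∀ n → s₂ (n * 2) ≡ s₂ n
s₂-*2 n = trans (cong s₂ (*-comm n 2)) (s₂-2* n)

s₂-1+*2 : ∀ n → s₂ (suc (n * 2)) ≡ suc (s₂ n)
s₂-1+*2 n = trans (cong (λ v → s₂ (suc v)) (*-comm n 2)) (s₂-1+2* n)

s₂-suc-fromDigits : ∀ ds → s₂ (suc (fromDigits ds)) ≤ suc (expansionSum ds)
s₂-suc-fromDigits [] = ≤-refl
s₂-suc-fromDigits (fzero ∷ ds) =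
  ≤-reflexive (trans (s₂-1+*2 (fromDigits ds)) (cong suc (s₂-fromDigits ds)))
s₂-suc-fromDigits (fsuc fzero ∷ ds) =
  ≤-trans (≤-reflexive (s₂-*2 (suc (fromDigits ds)))) (m≤n⇒m≤1+n (s₂-suc-fromDigits ds))

s₂-suc : ∀ n → s₂ (suc n) ≤ suc (s₂ n)
s₂-suc n = subst (λ v → s₂ (suc v) ≤ suc (s₂ n)) (proj₂ d) (s₂-suc-fromDigits (proj₁ d))
  where d = toDigits 2 n

-- Column addition: only a column 1 + 1 loses anything, trading two ones for one carry, and by
-- `s₂-suc` the carry raises the digit sum by at most one.
s₂-fromDigits-+ : ∀ ds es →
  s₂ (fromDigits ds + fromDigits es) ≤ expansionSum ds + expansionSum es
s₂-fromDigits-+ [] es = ≤-reflexive (s₂-fromDigits es)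
s₂-fromDigits-+ ds@(_ ∷ _) [] = ≤-reflexive
  (trans (cong s₂ (+-identityʳ (fromDigits ds))) (trans (s₂-fromDigits ds) (sym (+-identityʳ _))))
s₂-fromDigits-+ (fzero ∷ ds) (fzero ∷ es) = begin
  s₂ (x * 2 + y * 2) ≡⟨ cong s₂ (*-distribʳ-+ 2 x y) ⟨
  s₂ ((x + y) * 2)   ≡⟨ s₂-*2 (x + y) ⟩
  s₂ (x + y)         ≤⟨ s₂-fromDigits-+ ds es ⟩
  _                  ∎
  where
  open ≤-Reasoning
  x = fromDigits ds
  y = fromDigits es
s₂-fromDigits-+ (fzero ∷ ds) (fsuc fzero ∷ es) = begin
  s₂ (x * 2 + suc (y * 2)) ≡⟨ cong s₂ (lem x y) ⟩
  s₂ (suc ((x + y) * 2))   ≡⟨ s₂-1+*2 (x + y) ⟩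
  suc (s₂ (x + y))         ≤⟨ s≤s (s₂-fromDigits-+ ds es) ⟩
  suc (expansionSum ds + expansionSum es) ≡⟨ +-suc _ _ ⟨
  _                        ∎
  where
  open ≤-Reasoning
  x = fromDigits ds
  y = fromDigits es
  lem : ∀ x y → x * 2 + (1 + y * 2) ≡ 1 + (x + y) * 2
  lem = solve-∀
s₂-fromDigits-+ (fsuc fzero ∷ ds) (fzero ∷ es) = begin
  s₂ (suc (x * 2) + y * 2) ≡⟨ cong s₂ (lem x y) ⟩
  s₂ (suc ((x + y) * 2))   ≡⟨ s₂-1+*2 (x + y) ⟩
  suc (s₂ (x + y))         ≤⟨ s≤s (s₂-fromDigits-+ ds es) ⟩
  _                        ∎
  where
  open ≤-Reasoning
  x = fromDigits ds
  y = fromDigits es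
  lem : ∀ x y → (1 + x * 2) + y * 2 ≡ 1 + (x + y) * 2
  lem = solve-∀
s₂-fromDigits-+ (fsuc fzero ∷ ds) (fsuc fzero ∷ es) = begin
  s₂ (suc (x * 2) + suc (y * 2)) ≡⟨ cong s₂ (lem x y) ⟩
  s₂ (suc (x + y) * 2)           ≡⟨ s₂-*2 (suc (x + y)) ⟩
  s₂ (suc (x + y))               ≤⟨ s₂-suc (x + y) ⟩
  suc (s₂ (x + y))               ≤⟨ s≤s (s₂-fromDigits-+ ds es) ⟩
  suc (expansionSum ds + expansionSum es) ≤⟨ s≤s (+-monoʳ-≤ (expansionSum ds) (n≤1+n _)) ⟩
  _                              ∎
  where
  open ≤-Reasoning
  x = fromDigits ds
  y = fromDigits es
  lem : ∀ x y → (1 + x * 2) + (1 + y * 2) ≡ (1 + (x + y)) * 2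
  lem = solve-∀

s₂-subadditive : ∀ m n → s₂ (m + n) ≤ s₂ m + s₂ n
s₂-subadditive m n = subst₂ (λ u v → s₂ (u + v) ≤ s₂ m + s₂ n) (proj₂ d) (proj₂ e)
                            (s₂-fromDigits-+ (proj₁ d) (proj₁ e))
  where
  d = toDigits 2 m
  e = toDigits 2 n

-- `m` and `n` add up to a word of `l` ones, so at each position exactly one of them has a one.
-- Equal lowest bits would make `2 ^ l` odd for positive `l`.
s₂-complement : ∀ l m n → suc (m + n) ≡ 2 ^ l → s₂ m + s₂ n ≡ l
s₂-complement zero zero zero eq = refl
s₂-complement (suc l) m n eq with halve m | halve n
... | even m′ | even n′ = contradiction (trans (sym eq) (cong suc (sym (*-distribˡ-+ 2 m′ n′))))
                                        (even≢odd (2 ^ l) (m′ + n′))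
... | even m′ | odd n′ = begin
  s₂ (2 * m′) + s₂ (suc (2 * n′)) ≡⟨ cong₂ _+_ (s₂-2* m′) (s₂-1+2* n′) ⟩
  s₂ m′ + suc (s₂ n′)             ≡⟨ +-suc _ _ ⟩
  suc (s₂ m′ + s₂ n′)             ≡⟨ cong suc (s₂-complement l m′ n′
                                     (*-cancelˡ-≡ _ _ 2 (trans (lem m′ n′) eq))) ⟩
  suc l                           ∎
  where
  open ≡-Reasoning
  lem : ∀ m n → 2 * (1 + (m + n)) ≡ 1 + (2 * m + (1 + 2 * n))
  lem = solve-∀
... | odd m′ | even n′ = begin
  s₂ (suc (2 * m′)) + s₂ (2 * n′) ≡⟨ cong₂ _+_ (s₂-1+2* m′) (s₂-2* n′) ⟩
  suc (s₂ m′ + s₂ n′)             ≡⟨ cong suc (s₂-complement l m′ n′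
                                     (*-cancelˡ-≡ _ _ 2 (trans (lem m′ n′) eq))) ⟩
  suc l                           ∎
  where
  open ≡-Reasoning
  lem : ∀ m n → 2 * (1 + (m + n)) ≡ 1 + ((1 + 2 * m) + 2 * n)
  lem = solve-∀
... | odd m′ | odd n′ = contradiction (trans (sym eq) (lem m′ n′))
                                      (even≢odd (2 ^ l) (suc (m′ + n′)))
  where
  lem : ∀ m n → 1 + ((1 + 2 * m) + (1 + 2 * n)) ≡ 1 + 2 * (1 + (m + n))
  lem = solve-∀

-- As `l` fits into `i` bits, the summands occupy disjoint positions; the induction strips the
-- lowest bit, which comes from `l`.
s₂-split : ∀ i h l → l < 2 ^ i → s₂ (2 ^ i * h + l) ≡ s₂ h + s₂ l
s₂-split zero h zero l< =
  trans (cong s₂ (trans (+-identityʳ _) (*-identityˡ h))) (sym (+-identityʳ _))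
s₂-split zero h (suc l) (s≤s ())
s₂-split (suc i) h l l< with halve l
... | even l′ = begin
  s₂ (2 * 2 ^ i * h + 2 * l′)   ≡⟨ cong s₂ (lem (2 ^ i) h l′) ⟩
  s₂ (2 * (2 ^ i * h + l′))     ≡⟨ s₂-2* (2 ^ i * h + l′) ⟩
  s₂ (2 ^ i * h + l′)           ≡⟨ s₂-split i h l′ (*-cancelˡ-< 2 _ _ l<) ⟩
  s₂ h + s₂ l′                  ≡⟨ cong (s₂ h +_) (s₂-2* l′) ⟨
  s₂ h + s₂ (2 * l′)            ∎
  where
  open ≡-Reasoning
  lem : ∀ p h l → 2 * p * h + 2 * l ≡ 2 * (p * h + l)
  lem = solve-∀
... | odd l′ = begin
  s₂ (2 * 2 ^ i * h + suc (2 * l′))   ≡⟨ cong s₂ (lem (2 ^ i) h l′) ⟩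
  s₂ (suc (2 * (2 ^ i * h + l′)))     ≡⟨ s₂-1+2* (2 ^ i * h + l′) ⟩
  suc (s₂ (2 ^ i * h + l′))           ≡⟨ cong suc (s₂-split i h l′
                                           (*-cancelˡ-< 2 _ _ (<-trans (n<1+n _) l<))) ⟩
  suc (s₂ h + s₂ l′)                  ≡⟨ +-suc _ _ ⟨
  s₂ h + suc (s₂ l′)                  ≡⟨ cong (s₂ h +_) (s₂-1+2* l′) ⟨
  s₂ h + s₂ (suc (2 * l′))            ∎
  where
  open ≡-Reasoning
  lem : ∀ p h l → 2 * p * h + (1 + 2 * l) ≡ 1 + 2 * (p * h + l)
  lem = solve-∀

s₂-2^+ : ∀ l m → m < 2 ^ l → s₂ (2 ^ l + m) ≡ suc (s₂ m)
s₂-2^+ l m m< = trans (cong (λ v → s₂ (v + m)) (sym (*-identityʳ (2 ^ l)))) (s₂-split l 1 m m<)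

s₂-2^ : ∀ l → s₂ (2 ^ l) ≡ 1
s₂-2^ l = trans (cong s₂ (sym (+-identityʳ (2 ^ l)))) (s₂-2^+ l 0 (m^n>0 2 l))

fromDigits≡0 : ∀ ds → expansionSum ds ≡ 0 → fromDigits ds ≡ 0
fromDigits≡0 [] eq = refl
fromDigits≡0 (fzero ∷ ds) eq = cong (_* 2) (fromDigits≡0 ds eq)

fromDigits≡2^ : ∀ ds → expansionSum ds ≡ 1 → ∃ λ x → fromDigits ds ≡ 2 ^ x
fromDigits≡2^ (fzero ∷ ds) eq with fromDigits≡2^ ds eq
... | x , e = suc x , trans (cong (_* 2) e) (*-comm (2 ^ x) 2)
fromDigits≡2^ (fsuc fzero ∷ ds) eq =
  0 , cong (λ v → suc (v * 2)) (fromDigits≡0 ds (suc-injective eq))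

s₂≡1⇒2^ : ∀ n → s₂ n ≡ 1 → ∃ λ x → n ≡ 2 ^ x
s₂≡1⇒2^ n eq with fromDigits≡2^ (proj₁ (toDigits 2 n)) eq
... | x , e = x , trans (sym (proj₂ (toDigits 2 n))) e

-- Powers of two and multiples modulo k = 2 ^ i ∸ 1

n<2^n : ∀ n → n < 2 ^ n
n<2^n zero = s≤s z≤n
n<2^n (suc n) = begin-strict
  suc n           <⟨ s≤s (n<2^n n) ⟩
  1 + 2 ^ n       ≤⟨ +-monoˡ-≤ (2 ^ n) (m^n>0 2 n) ⟩
  2 ^ n + 2 ^ n   ≡⟨ cong (2 ^ n +_) (+-identityʳ (2 ^ n)) ⟨
  2 ^ suc n       ∎
  where open ≤-Reasoning

module Mersenne {i k : ℕ} (2^i≡ : 2 ^ i ≡ suc k) (2≤i : 2 ≤ i) where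

  i≤k : i ≤ k
  i≤k = s≤s⁻¹ (subst (i <_) 2^i≡ (n<2^n i))

  2≤k : 2 ≤ k
  2≤k = ≤-trans 2≤i i≤k

  instance
    k≢0 : NonZero k
    k≢0 = >-nonZero (≤-trans (s≤s z≤n) 2≤k)

  2^[n*i] : ∀ n → ∃ λ t → 2 ^ (n * i) ≡ 1 + t * k
  2^[n*i] zero = 0 , refl
  2^[n*i] (suc n) with 2^[n*i] n
  ... | t , eq = 1 + (1 + k) * t , (begin
    2 ^ (i + n * i)       ≡⟨ ^-distribˡ-+-* 2 i (n * i) ⟩
    2 ^ i * 2 ^ (n * i)   ≡⟨ cong₂ _*_ 2^i≡ eq ⟩
    suc k * (1 + t * k)   ≡⟨ lem k t ⟩
    1 + (1 + (1 + k) * t) * k ∎)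
    where
    open ≡-Reasoning
    lem : ∀ k t → (1 + k) * (1 + t * k) ≡ 1 + (1 + (1 + k) * t) * k
    lem = solve-∀

  -- Since `2 ^ i` is 1 modulo `k`, `n = 2 ^ i * h + l` folds to `h + l`, again a multiple of `k`,
  -- smaller for positive `h` and of no larger digit sum. The descent ends at `h = 0`, where `n` can
  -- only be `k` itself, with `i` ones.
  i≤s₂ : ∀ n → 0 < n → k ∣ n → i ≤ s₂ n
  i≤s₂ = <-rec _ step
    where
    instance
      2^i≢0 : NonZero (2 ^ i)
      2^i≢0 = m^n≢0 2 i
    step : ∀ n → (∀ {m} → m < n → 0 < m → k ∣ m → i ≤ s₂ m) → 0 < n → k ∣ n → i ≤ s₂ n
    step n rec 0<n k∣n = go (n / 2 ^ i) (n % 2 ^ i) (m%n<n n (2 ^ i))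
      (trans (m≡m%n+[m/n]*n n (2 ^ i)) (trans (+-comm (n % 2 ^ i) _)
        (cong (_+ n % 2 ^ i) (*-comm (n / 2 ^ i) (2 ^ i)))))
      where
      go : ∀ h l → l < 2 ^ i → n ≡ 2 ^ i * h + l → i ≤ s₂ n
      go zero l l< n≡ = ≤-reflexive (begin
        i              ≡⟨ s₂-complement i k 0 (trans (cong suc (+-identityʳ k)) (sym 2^i≡)) ⟨
        s₂ k + s₂ 0    ≡⟨ +-identityʳ (s₂ k) ⟩
        s₂ k           ≡⟨ cong s₂ (≤-antisym (∣⇒≤ {{>-nonZero 0<n}} k∣n) n≤k) ⟩
        s₂ n           ∎)
        where
        open ≡-Reasoning
        n≤k : n ≤ k
        n≤k = s≤s⁻¹ (subst₂ _<_ (sym (trans n≡ (cong (_+ l) (*-zeroʳ (2 ^ i))))) 2^i≡ l<)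
      go h@(suc h′) l l< n≡ = begin
        i               ≤⟨ rec h+l<n (s≤s z≤n) k∣h+l ⟩
        s₂ (h + l)      ≤⟨ s₂-subadditive h l ⟩
        s₂ h + s₂ l     ≡⟨ s₂-split i h l l< ⟨
        s₂ (2 ^ i * h + l) ≡⟨ cong s₂ n≡ ⟨
        s₂ n            ∎
        where
        open ≤-Reasoning
        lem : ∀ k h l → (1 + k) * h + l ≡ k * h + (h + l)
        lem = solve-∀
        n≡′ : n ≡ k * h + (h + l)
        n≡′ = trans n≡ (trans (cong (λ v → v * h + l) 2^i≡) (lem k h l))
        k∣h+l : k ∣ h + l
        k∣h+l = ∣m+n∣m⇒∣n (subst (k ∣_) n≡′ k∣n) (m∣m*n h)
        h+l<n : h + l < n
        h+l<n = subst (h + l <_) (sym n≡′)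
          (+-monoˡ-< (h + l) (*-mono-≤ (≤-trans (s≤s z≤n) 2≤k) (s≤s (z≤n {h′}))))

  -- With e = k ∸ i this is the value in the theorem, free of subtractions.
  candidate : ∀ {e l} n m → k ≡ e + i → l ≡ n * i → k ≤ l →
              suc (m + 2 ^ e) ≡ 2 ^ l + 2 ^ k → Candidate k m
  candidate {e} {l} n m k≡ l≡ k≤l m≡ = 0<m , divides (t + 2 ^ e) m≡tk , s₂m≡k
    where
    t = proj₁ (2^[n*i] n)
    2^l≡ : 2 ^ l ≡ 1 + t * k
    2^l≡ = trans (cong (2 ^_) l≡) (proj₂ (2^[n*i] n))
    2^k≡ : 2 ^ k ≡ 2 ^ e * suc k
    2^k≡ = trans (cong (2 ^_) k≡) (trans (^-distribˡ-+-* 2 e i) (cong (2 ^ e *_) 2^i≡))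
    -- Modulo `k`, `2 ^ l` cancels the subtracted 1, and `2 ^ k = 2 ^ e * 2 ^ i` cancels the
    -- subtracted `2 ^ e`.
    m≡tk : m ≡ (t + 2 ^ e) * k
    m≡tk = +-cancelʳ-≡ (2 ^ e) _ _ (suc-injective
      (trans m≡ (trans (cong₂ _+_ 2^l≡ 2^k≡) (lem t k (2 ^ e)))))
      where
      lem : ∀ t k p → (1 + t * k) + p * (1 + k) ≡ 1 + ((t + p) * k + p)
      lem = solve-∀
    e<k : e < k
    e<k = subst (e <_) (sym k≡) (m<m+n e (≤-trans (s≤s z≤n) 2≤i))
    2^e<2^k : 2 ^ e < 2 ^ k
    2^e<2^k = ^-monoʳ-< 2 (s≤s (s≤s z≤n)) e<k
    -- `w` is a word of `k` ones with the one at position `e` deleted; the leading bit `2 ^ l`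
    -- restores the digit sum `k`.
    w = 2 ^ k ∸ suc (2 ^ e)
    w≡ : suc (w + 2 ^ e) ≡ 2 ^ k
    w≡ = trans (sym (+-suc w (2 ^ e))) (m∸n+n≡m 2^e<2^k)
    m≡2^l+w : m ≡ 2 ^ l + w
    m≡2^l+w = +-cancelʳ-≡ (2 ^ e) _ _ (suc-injective (begin
      suc (m + 2 ^ e)           ≡⟨ m≡ ⟩
      2 ^ l + 2 ^ k             ≡⟨ cong (2 ^ l +_) w≡ ⟨
      2 ^ l + suc (w + 2 ^ e)   ≡⟨ +-suc _ _ ⟩
      suc (2 ^ l + (w + 2 ^ e)) ≡⟨ cong suc (+-assoc (2 ^ l) w (2 ^ e)) ⟨
      suc (2 ^ l + w + 2 ^ e)   ∎))
      where open ≡-Reasoning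
    w<2^l : w < 2 ^ l
    w<2^l = <-≤-trans (subst (w <_) w≡ (s≤s (m≤m+n w (2 ^ e)))) (^-monoʳ-≤ 2 k≤l)
    s₂m≡k : s₂ m ≡ k
    s₂m≡k = begin
      s₂ m                ≡⟨ cong s₂ m≡2^l+w ⟩
      s₂ (2 ^ l + w)      ≡⟨ s₂-2^+ l w w<2^l ⟩
      1 + s₂ w            ≡⟨ +-comm 1 (s₂ w) ⟩
      s₂ w + 1            ≡⟨ cong (s₂ w +_) (s₂-2^ e) ⟨
      s₂ w + s₂ (2 ^ e)   ≡⟨ s₂-complement k w (2 ^ e) w≡ ⟩
      k                   ∎
      where open ≡-Reasoning
    0<m : 0 < m
    0<m = subst (0 <_) (sym m≡2^l+w) (≤-trans (m^n>0 2 l) (m≤m+n (2 ^ l) w))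

  -- The equations encode `k = 1 + (q + 1) * i`, `e = k - i` and `l = k + i - 1`. So `e` is 1 modulo
  -- `i` and `l` is a multiple of `i`, and modulo `k` the powers `2 ^ e` and `2 ^ l` reduce to 2 and
  -- 1.
  module _ {q e l j} (k≡ : k ≡ e + i) (e≡ : e ≡ 1 + q * i) (i≡ : i ≡ suc j) (l≡ : l ≡ k + j) where

    l≡ni : l ≡ suc (suc q) * i
    l≡ni = trans l≡ (trans (cong (_+ j) k≡) (trans (cong₂ (λ u v → u + v + j) e≡ i≡)
      (trans (lem (q * i) j) (cong (λ v → v + (v + q * i)) (sym i≡)))))
      where
      lem : ∀ u j → (1 + u) + (1 + j) + j ≡ (1 + j) + ((1 + j) + u)
      lem = solve-∀

    private
      t = proj₁ (2^[n*i] (suc (suc q)))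
      2^l≡ : 2 ^ l ≡ 1 + t * k
      2^l≡ = trans (cong (2 ^_) l≡ni) (proj₂ (2^[n*i] (suc (suc q))))

      -- A smaller candidate would have a complement `n` in `l` bits. As `k` divides `2 ^ l - 1`, it
      -- divides `n`, whose digit sum `l - k = j` falls short of `i`, against `i≤s₂`.
      2^l-bound : ∀ m → Candidate k m → 2 ^ l ≤ m
      2^l-bound m (0<m , k∣m , s₂m≡k) = ≮⇒≥ impossible
        where
        impossible : m < 2 ^ l → ⊥
        impossible m<2^l = contradiction (i≤s₂ n 0<n k∣n)
          (<⇒≱ (subst (s₂ n <_) (sym i≡) (s≤s (≤-reflexive s₂n≡j))))
          where
          n = 2 ^ l ∸ suc m
          n≡ : suc (m + n) ≡ 2 ^ l
          n≡ = m+[n∸m]≡n m<2^l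
          s₂n≡j : s₂ n ≡ j
          s₂n≡j = +-cancelˡ-≡ k _ _ (trans (cong (_+ s₂ n) (sym s₂m≡k))
            (trans (s₂-complement l m n n≡) l≡))
          0<n : 0 < n
          0<n = n≢0⇒n>0 λ n≡0 → <⇒≱ 2≤i (≤-reflexive (trans i≡ (cong suc
            (trans (sym s₂n≡j) (cong s₂ n≡0)))))
          k∣n : k ∣ n
          k∣n = ∣m+n∣m⇒∣n (divides t (suc-injective (trans n≡ 2^l≡))) k∣m

      -- Here `w` is a word of `k` ones without the one at position `x = e + r`, where `0 < r < i`.
      -- With `v = 2 ^ r - 1`, `suc w` equals `2 ^ e * (k - v)`, so `k` divides `2 ^ e * v`. Since
      -- `2 ^ e` is 2 modulo `k`, it divides `2 * v = 2 ^ (r + 1) - 2`, a positive number below `k`.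
      missing-bit : ∀ w x → k ∣ suc w → suc w + 2 ^ x ≡ 2 ^ k → e < x → ⊥
      missing-bit w x k∣ eq e<x = contradiction (∣⇒≤ {{>-nonZero 0<2v}} k∣2v) (<⇒≱ 2v<k)
        where
        r = x ∸ e
        0<r : 0 < r
        0<r = m<n⇒0<n∸m e<x
        x<k : x < k
        x<k = ≰⇒> λ k≤x → <⇒≱ (m<n+m (2 ^ x) {suc w} (s≤s z≤n))
          (≤-trans (≤-reflexive eq) (^-monoʳ-≤ 2 k≤x))
        r<i : r < i
        r<i = +-cancelˡ-< e _ _ (subst₂ _<_ (sym (m+[n∸m]≡n (<⇒≤ e<x))) k≡ x<k)
        v = 2 ^ r ∸ 1
        v≡ : suc v ≡ 2 ^ r
        v≡ = m+[n∸m]≡n (m^n>0 2 r)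
        0<v : 0 < v
        0<v = s≤s⁻¹ (subst (2 ≤_) (sym v≡) (≤-trans (s≤s 0<r) (n<2^n r)))
        0<2v : 0 < 2 * v
        0<2v = *-mono-≤ {1} {2} (s≤s z≤n) 0<v
        2v<k : 2 * v < k
        2v<k = s≤s⁻¹ (begin
          suc (suc (2 * v))  ≡⟨ *-suc 2 v ⟨
          2 * suc v          ≡⟨ cong (2 *_) v≡ ⟩
          2 ^ suc r          ≤⟨ ^-monoʳ-≤ 2 r<i ⟩
          2 ^ i              ≡⟨ 2^i≡ ⟩
          suc k              ∎)
          where open ≤-Reasoning
        u = proj₁ (2^[n*i] q)
        2^e≡ : 2 ^ e ≡ 2 * (1 + u * k)
        2^e≡ = trans (cong (2 ^_) e≡) (cong (2 *_) (proj₂ (2^[n*i] q)))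
        2^x≡ : 2 ^ x ≡ 2 ^ e * suc v
        2^x≡ = trans (cong (2 ^_) (sym (m+[n∸m]≡n (<⇒≤ e<x))))
          (trans (^-distribˡ-+-* 2 e r) (cong (2 ^ e *_) (sym v≡)))
        2^k≡ : 2 ^ k ≡ 2 ^ e * suc k
        2^k≡ = trans (cong (2 ^_) k≡) (trans (^-distribˡ-+-* 2 e i) (cong (2 ^ e *_) 2^i≡))
        w+ev : suc w + 2 ^ e * v ≡ 2 ^ e * k
        w+ev = +-cancelˡ-≡ (2 ^ e) _ _ (begin
          2 ^ e + (suc w + 2 ^ e * v)  ≡⟨ lem (2 ^ e) (suc w) v ⟩
          suc w + 2 ^ e * suc v        ≡⟨ cong (suc w +_) 2^x≡ ⟨
          suc w + 2 ^ x                ≡⟨ eq ⟩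
          2 ^ k                        ≡⟨ 2^k≡ ⟩
          2 ^ e * suc k                ≡⟨ *-suc (2 ^ e) k ⟩
          2 ^ e + 2 ^ e * k            ∎)
          where
          open ≡-Reasoning
          lem : ∀ p w v → p + (w + p * v) ≡ w + p * (1 + v)
          lem = solve-∀
        k∣ev : k ∣ 2 ^ e * v
        k∣ev = ∣m+n∣m⇒∣n (subst (k ∣_) (sym w+ev) (n∣m*n (2 ^ e))) k∣
        k∣2v : k ∣ 2 * v
        k∣2v = ∣m+n∣m⇒∣n {m = 2 * u * v * k}
          (subst (k ∣_) (trans (cong (_* v) 2^e≡) (lem u k v)) k∣ev)
          (n∣m*n (2 * u * v))
          where
          lem : ∀ u k v → 2 * (1 + u * k) * v ≡ 2 * u * v * k + 2 * v
          lem = solve-∀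

    -- Write `m = 2 ^ l + w`. If `m` were too small, `w` would fit into `k` bits with `k ∸ 1` ones,
    -- hence miss a single power `2 ^ x`; lying below the claimed value forces `e < x`, which
    -- `missing-bit` excludes.
    candidate-≥ : ∀ m → Candidate k m → 2 ^ l + 2 ^ k ≤ suc (m + 2 ^ e)
    candidate-≥ m cand@(0<m , k∣m , s₂m≡k) = ≮⇒≥ impossible
      where
      w = m ∸ 2 ^ l
      m≡ : 2 ^ l + w ≡ m
      m≡ = m+[n∸m]≡n (2^l-bound m cand)
      impossible : suc (m + 2 ^ e) < 2 ^ l + 2 ^ k → ⊥
      impossible m< = missing-bit w x k∣1+w (trans (cong (suc w +_) (sym n≡2^x)) n≡) e<x
        where
        w+e< : suc (w + 2 ^ e) < 2 ^ k
        w+e< = +-cancelˡ-< (2 ^ l) _ _ (subst (_< 2 ^ l + 2 ^ k)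
          (trans (cong (λ v → suc (v + 2 ^ e)) (sym m≡)) (lem (2 ^ l) w (2 ^ e))) m<)
          where
          lem : ∀ l w e → 1 + (l + w + e) ≡ l + (1 + (w + e))
          lem = solve-∀
        w<2^k : w < 2 ^ k
        w<2^k = <-trans (s≤s (m≤m+n w (2 ^ e))) w+e<
        w<2^l : w < 2 ^ l
        w<2^l = <-≤-trans w<2^k (^-monoʳ-≤ 2 (subst (k ≤_) (sym l≡) (m≤m+n k j)))
        n = 2 ^ k ∸ suc w
        n≡ : suc w + n ≡ 2 ^ k
        n≡ = m+[n∸m]≡n w<2^k
        s₂n≡1 : s₂ n ≡ 1
        s₂n≡1 = +-cancelˡ-≡ (s₂ w) _ _ (begin
          s₂ w + s₂ n     ≡⟨ s₂-complement k w n n≡ ⟩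
          k               ≡⟨ s₂m≡k ⟨
          s₂ m            ≡⟨ cong s₂ m≡ ⟨
          s₂ (2 ^ l + w)  ≡⟨ s₂-2^+ l w w<2^l ⟩
          1 + s₂ w        ≡⟨ +-comm 1 (s₂ w) ⟩
          s₂ w + 1        ∎)
          where open ≡-Reasoning
        x = proj₁ (s₂≡1⇒2^ n s₂n≡1)
        n≡2^x : n ≡ 2 ^ x
        n≡2^x = proj₂ (s₂≡1⇒2^ n s₂n≡1)
        2^e<n : 2 ^ e < n
        2^e<n = +-cancelˡ-< (suc w) _ _ (subst (suc w + 2 ^ e <_) (sym n≡) w+e<)
        e<x : e < x
        e<x = ≰⇒> λ x≤e → <⇒≱ (subst (2 ^ e <_) n≡2^x 2^e<n) (^-monoʳ-≤ 2 x≤e)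
        k∣1+w : k ∣ suc w
        k∣1+w = ∣m+n∣m⇒∣n (subst (k ∣_) (begin
          m                    ≡⟨ m≡ ⟨
          2 ^ l + w            ≡⟨ cong (_+ w) 2^l≡ ⟩
          suc (t * k + w)      ≡⟨ +-suc (t * k) w ⟨
          t * k + suc w        ∎) k∣m) (n∣m*n t)
          where open ≡-Reasoning

-- Fermat's little theorem to base two

-- Used to show that a prime `suc n` divides its interior binomial coefficients. Pascal's rule
-- splits the coefficient; once one copy of `A` is set aside, the rest is covered by the induction
-- hypotheses for `j` and `suc j`.
C-absorption : ∀ n j → suc j * (suc n C suc j) ≡ suc n * (n C j)
C-absorption zero zero = refl
C-absorption zero (suc j) = *-zeroʳ j
C-absorption (suc n) zero = trans (*-identityˡ _) (trans (nC1≡n (suc (suc n))) (sym (*-identityʳ _)))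
C-absorption (suc n) (suc j) = begin
  (2 + j) * (suc (suc n) C suc (suc j))
    ≡⟨ cong ((2 + j) *_) (nCk+nC[k+1]≡[n+1]C[k+1] (suc n) (suc j)) ⟨
  (2 + j) * (A + B)
    ≡⟨ lem j A B ⟩
  A + (suc j * A + (2 + j) * B)
    ≡⟨ cong (A +_) (cong₂ _+_ (C-absorption n j) (C-absorption n (suc j))) ⟩
  A + (suc n * (n C j) + suc n * (n C suc j))
    ≡⟨ cong (A +_) (*-distribˡ-+ (suc n) (n C j) (n C suc j)) ⟨
  A + suc n * (n C j + n C suc j)
    ≡⟨ cong (λ v → A + suc n * v) (nCk+nC[k+1]≡[n+1]C[k+1] n j) ⟩
  (2 + n) * A ∎
  where
  open ≡-Reasoning
  A = suc n C suc j
  B = suc n C suc (suc j)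
  lem : ∀ j a b → (2 + j) * (a + b) ≡ a + ((1 + j) * a + (2 + j) * b)
  lem = solve-∀

rowSum : ℕ → ℕ → ℕ
rowSum n zero = 0
rowSum n (suc j) = rowSum n j + n C j

rowSum-suc : ∀ n j → rowSum (suc n) (suc j) ≡ rowSum n (suc j) + rowSum n j
rowSum-suc n zero = refl
rowSum-suc n (suc j) = begin
  rowSum (suc n) (suc j) + suc n C suc j
    ≡⟨ cong₂ _+_ (rowSum-suc n j) (sym (nCk+nC[k+1]≡[n+1]C[k+1] n j)) ⟩
  (rowSum n (suc j) + rowSum n j) + (n C j + n C suc j)
    ≡⟨ lem (rowSum n (suc j)) (rowSum n j) (n C j) (n C suc j) ⟩
  (rowSum n (suc j) + n C suc j) + (rowSum n j + n C j) ∎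
  where
  open ≡-Reasoning
  lem : ∀ a b c d → (a + b) + (c + d) ≡ (a + d) + (b + c)
  lem = solve-∀

-- With `n < j` the sum covers the whole row, entries past its end being zero, and by `rowSum-suc`
-- each new row doubles the total.
rowSum≡2^ : ∀ n j → n < j → rowSum n j ≡ 2 ^ n
rowSum≡2^ zero (suc zero) n<j = refl
rowSum≡2^ zero (suc (suc j)) n<j =
  trans (+-identityʳ (rowSum 0 (suc j))) (rowSum≡2^ zero (suc j) (s≤s z≤n))
rowSum≡2^ (suc n) (suc j) (s≤s n<j) = begin
  rowSum (suc n) (suc j)        ≡⟨ rowSum-suc n j ⟩
  rowSum n (suc j) + rowSum n j ≡⟨ cong₂ _+_ (rowSum≡2^ n (suc j) (m<n⇒m<1+n n<j)) (rowSum≡2^ n j n<j) ⟩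
  2 ^ n + 2 ^ n                 ≡⟨ cong (2 ^ n +_) (+-identityʳ (2 ^ n)) ⟨
  2 ^ suc n                     ∎
  where open ≡-Reasoning

-- By absorption `p` divides `suc j * (p C suc j)`, and it is too large to divide `suc j`.
prime∣C : ∀ {p} → Prime p → ∀ j → suc j < p → p ∣ p C suc j
prime∣C {suc n} pp j j<p
  with euclidsLemma (suc j) (suc n C suc j) pp
         (divides (n C j) (trans (C-absorption n j) (*-comm (suc n) (n C j))))
... | inj₁ p∣j = contradiction (∣⇒≤ p∣j) (<⇒≱ j<p)
... | inj₂ p∣C = p∣C

prime-rowSum : ∀ {p} → Prime p → ∀ j → j < p → ∃ λ t → rowSum p (suc j) ≡ 1 + t * p
prime-rowSum pp zero j<p = 0 , refl
prime-rowSum {p} pp (suc j) j<p with prime-rowSum pp j (<-trans (n<1+n j) j<p) | prime∣C pp j j<p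
... | t , eq | divides u C≡ = t + u ,
  trans (cong₂ _+_ eq C≡) (cong suc (sym (*-distribʳ-+ p t u)))

-- The row of `p` sums to `2 ^ p`; its two end entries give the 2, and the interior ones are
-- multiples of `p`.
fermat₂ : ∀ {p} → Prime p → ∃ λ t → 2 ^ p ≡ 2 + t * p
fermat₂ {suc n} pp with prime-rowSum pp n ≤-refl
... | t , eq = t , (begin
  2 ^ suc n                                ≡⟨ rowSum≡2^ (suc n) (suc (suc n)) ≤-refl ⟨
  rowSum (suc n) (suc n) + suc n C suc n   ≡⟨ cong₂ _+_ eq (nCn≡1 (suc n)) ⟩
  1 + t * suc n + 1                        ≡⟨ +-comm _ 1 ⟩
  2 + t * suc n                            ∎)
  where open ≡-Reasoning

-- The order of 2 modulo k = 2 ^ i ∸ 1 is i, and 2 ^ k ≡ 2.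
prime⇒k≡1+qi : ∀ {i k} → 2 ^ i ≡ suc k → 2 ≤ i → Prime k → ∃ λ q → k ≡ 1 + suc q * i
prime⇒k≡1+qi {i} {k} 2^i≡ 2≤i pp = go (k / i)
  (trans (m≡m%n+[m/n]*n k i) (cong (_+ k / i * i) (2^-injective-1 r 2^r≡2)))
  where
  open Mersenne 2^i≡ 2≤i
  instance
    i≢0 : NonZero i
    i≢0 = >-nonZero (≤-trans (s≤s z≤n) 2≤i)
  r = k % i
  2<k : 2 < k
  2<k = s≤s⁻¹ (subst (4 ≤_) 2^i≡ (^-monoʳ-≤ 2 2≤i))
  2^r<k : 2 ^ r < k
  2^r<k = *-cancelˡ-< 2 _ _ (begin-strict
    2 ^ suc r   ≤⟨ ^-monoʳ-≤ 2 (m%n<n k i) ⟩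
    2 ^ i       ≡⟨ 2^i≡ ⟩
    suc k       <⟨ +-monoˡ-< k 2≤k ⟩
    k + k       ≡⟨ cong (k +_) (+-identityʳ k) ⟨
    2 * k       ∎)
    where open ≤-Reasoning
  t = proj₁ (fermat₂ pp)
  s = proj₁ (2^[n*i] (k / i))
  -- Modulo `k`, `2 ^ k` is `2 ^ r` because `2 ^ i` is 1, and it is 2 by Fermat. Both values lie
  -- below `k`, so the congruence is an equality.
  2^r≡2 : 2 ^ r ≡ 2
  2^r≡2 = begin
    2 ^ r                       ≡⟨ m<n⇒m%n≡m 2^r<k ⟨
    2 ^ r % k                   ≡⟨ [m+kn]%n≡m%n (2 ^ r) (2 ^ r * s) k ⟨
    (2 ^ r + 2 ^ r * s * k) % k ≡⟨ cong (_% k) (lem (2 ^ r) s k) ⟩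
    (2 ^ r * (1 + s * k)) % k   ≡⟨ cong (λ v → (2 ^ r * v) % k) (proj₂ (2^[n*i] (k / i))) ⟨
    (2 ^ r * 2 ^ (k / i * i)) % k ≡⟨ cong (_% k) (^-distribˡ-+-* 2 r (k / i * i)) ⟨
    (2 ^ (r + k / i * i)) % k   ≡⟨ cong (λ v → 2 ^ v % k) (m≡m%n+[m/n]*n k i) ⟨
    2 ^ k % k                   ≡⟨ cong (_% k) (proj₂ (fermat₂ pp)) ⟩
    (2 + t * k) % k             ≡⟨ [m+kn]%n≡m%n 2 t k ⟩
    2 % k                       ≡⟨ m<n⇒m%n≡m 2<k ⟩
    2                           ∎
    where
    open ≡-Reasoning
    lem : ∀ p s k → p + p * s * k ≡ p * (1 + s * k)
    lem = solve-∀
  2^-injective-1 : ∀ r → 2 ^ r ≡ 2 → r ≡ 1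
  2^-injective-1 (suc zero) eq = refl
  2^-injective-1 (suc (suc r)) eq = contradiction (≤-reflexive eq)
    (<⇒≱ (*-monoʳ-< 2 {1} {2 ^ suc r} (*-monoʳ-≤ 2 (m^n>0 2 r))))
  go : ∀ d → k ≡ 1 + d * i → ∃ λ q → k ≡ 1 + suc q * i
  go zero k≡ = contradiction (≤-reflexive k≡) (<⇒≱ 2≤k)
  go (suc q) k≡ = q , k≡

-- The least candidate

negResidue⇒∣ : ∀ i k {m} → NegResidue i k m → i ∣ m + k
negResidue⇒∣ i k {m} (_ , d) = subst (λ z → i ∣ ℤ.∣ ℤ.+ m ℤ.+ z ∣) (ℤ.neg-involutive (ℤ.+ k)) d

∣⇒negResidue : ∀ i k {m} → 0 < m → i ∣ m + k → NegResidue i k m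
∣⇒negResidue i k {m} 0<m d =
  0<m , subst (λ z → i ∣ ℤ.∣ ℤ.+ m ℤ.+ z ∣) (sym (ℤ.neg-involutive (ℤ.+ k))) d

-- As `k` is 1 modulo `i`, the residue sought is that of -1: `j = i - 1` qualifies, and `i` dividing
-- `suc k⁻` forces `j ≤ k⁻`.
negResidue≡ : ∀ {i k k⁻} .{{_ : NonZero i}} q j → IsLeast (NegResidue i k) k⁻ →
               i ≡ suc j → 0 < j → k ≡ 1 + q * i → k⁻ ≡ j
negResidue≡ {i} {k} {k⁻} q j (isRes , least) i≡ 0<j k≡ = ≤-antisym
  (least j (∣⇒negResidue i k 0<j (divides (suc q) j+k≡)))
  (s≤s⁻¹ (subst (_≤ suc k⁻) i≡ (∣⇒≤ i∣1+k⁻)))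
  where
  j+k≡ : j + k ≡ suc q * i
  j+k≡ = trans (cong (j +_) k≡) (trans (+-suc j (q * i)) (cong (_+ q * i) (sym i≡)))
  i∣1+k⁻ : i ∣ suc k⁻
  i∣1+k⁻ = ∣m+n∣m⇒∣n
    (subst (i ∣_) (trans (cong (k⁻ +_) k≡) (lem k⁻ (q * i))) (negResidue⇒∣ i k isRes)) (n∣m*n q)
    where
    lem : ∀ a b → a + (1 + b) ≡ b + (1 + a)
    lem = solve-∀

value : ℕ → ℕ → ℕ → ℕ
value l k e = 2 ^ l + 2 ^ k ∸ 2 ^ e ∸ 1

-- The truncated subtractions are exact because `1 ≤ 2 ^ l` and `2 ^ e ≤ 2 ^ k`.
value-+ : ∀ l {k e} → e ≤ k → suc (value l k e + 2 ^ e) ≡ 2 ^ l + 2 ^ k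
value-+ l {k} {e} e≤k = begin
  suc (value l k e + p)             ≡⟨ +-suc (value l k e) p ⟨
  value l k e + suc p               ≡⟨ cong (_+ suc p) (∸-+-assoc (2 ^ l + 2 ^ k) p 1) ⟩
  2 ^ l + 2 ^ k ∸ (p + 1) + suc p   ≡⟨ cong (λ v → 2 ^ l + 2 ^ k ∸ v + suc p) (+-comm p 1) ⟩
  2 ^ l + 2 ^ k ∸ suc p + suc p     ≡⟨ m∸n+n≡m (+-mono-≤ (m^n>0 2 l) (^-monoʳ-≤ 2 e≤k)) ⟩
  2 ^ l + 2 ^ k                     ∎
  where
  open ≡-Reasoning
  p = 2 ^ e

2^i≡1+k : ∀ i {k} → k ≡ 2 ^ i ∸ 1 → 2 ^ i ≡ suc k
2^i≡1+k i k≡ = trans (sym (m+[n∸m]≡n (m^n>0 2 i))) (cong suc (sym k≡))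

-- Stated for arbitrary least elements: a-least and negResidue-least are
-- costly to unfold.
module LeastCandidate {i k : ℕ} .{{_ : NonZero i}} .{{_ : NonZero k}} (2≤i : 2 ≤ i) (k≡ : k ≡ 2 ^ i ∸ 1)
  (aₖ-least : ∃ (IsLeast (Candidate k))) (k⁻-least : ∃ (IsLeast (NegResidue i k))) where

  private
    aₖ = proj₁ aₖ-least
    k⁻ = proj₁ k⁻-least
    2^i≡ : 2 ^ i ≡ suc k
    2^i≡ = 2^i≡1+k i k≡
    open Mersenne 2^i≡ 2≤i using (i≤k; candidate; candidate-≥)
    k≡e+i : k ≡ k ∸ i + i
    k≡e+i = sym (m∸n+n≡m i≤k)

  -- By the choice of `k⁻` the exponent `k + k⁻` is a multiple of `i`, as `candidate` demands of its
  -- leading bit.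
  a-≤ : aₖ ≤ value (k + k⁻) k (k ∸ i)
  a-≤ with negResidue⇒∣ i k (proj₁ (proj₂ k⁻-least))
  ... | divides n eq = proj₂ (proj₂ aₖ-least) _ (candidate n _ k≡e+i (trans (+-comm k k⁻) eq) (m≤m+n k k⁻)
                                       (value-+ (k + k⁻) (m∸n≤m k i)))

  module _ (pk : Prime k) where

    private
      q = proj₁ (prime⇒k≡1+qi 2^i≡ 2≤i pk)
      k≡1+ : k ≡ 1 + suc q * i
      k≡1+ = proj₂ (prime⇒k≡1+qi 2^i≡ 2≤i pk)
      j = i ∸ 1
      i≡ : i ≡ suc j
      i≡ = sym (m+[n∸m]≡n (≤-trans (s≤s z≤n) 2≤i))
      e≡ : k ∸ i ≡ 1 + q * i
      e≡ = +-cancelʳ-≡ i _ _ (trans (m∸n+n≡m i≤k) (trans k≡1+ (cong suc (+-comm i (q * i)))))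

    prime⇒negResidue≡ : k⁻ ≡ i ∸ 1
    prime⇒negResidue≡ = negResidue≡ (suc q) j (proj₂ k⁻-least) i≡ (s≤s⁻¹ (subst (2 ≤_) i≡ 2≤i)) k≡1+

    prime⇒a≡ : aₖ ≡ value (k + k⁻) k (k ∸ i)
    prime⇒a≡ = ≤-antisym a-≤ (+-cancelʳ-≤ (2 ^ (k ∸ i)) _ _ (s≤s⁻¹ (≤-trans
      (≤-reflexive (value-+ (k + k⁻) (m∸n≤m k i)))
      (candidate-≥ {q = q} k≡e+i e≡ i≡ (cong (k +_) prime⇒negResidue≡) aₖ (proj₁ (proj₂ aₖ-least))))))

    prime⇒a≡′ : aₖ ≡ value (k + i ∸ 1) k (k ∸ i)
    prime⇒a≡′ = trans prime⇒a≡ (cong (λ l → value l k (k ∸ i))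
      (trans (cong (k +_) prime⇒negResidue≡) (sym (+-∸-assoc k (≤-trans (s≤s z≤n) 2≤i)))))

    -- Since 2 ^ (k + i ∸ 1) = 2 ^ (k ∸ 1) (k + 1), the leading term of aₖ
    -- contributes k · 2 ^ (k ∸ 1).
    prime⇒c-bounds : ∀ c → aₖ ≡ c * k → ∃ λ d → 2 * c ≡ 2 ^ k + 2 * d × d * k < 2 * 2 ^ k
    prime⇒c-bounds c ck≡ = d , 2c≡ , dk<
      where
      h = suc q * i
      p = 2 ^ h
      e = k ∸ i
      2^k≡ : 2 ^ k ≡ 2 * p
      2^k≡ = cong (2 ^_) k≡1+
      2^l≡ : 2 ^ (k + k⁻) ≡ p * suc k
      2^l≡ = trans (cong (2 ^_) (trans (cong₂ _+_ k≡1+ prime⇒negResidue≡)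
          (trans (sym (+-suc h j)) (cong (h +_) (sym i≡)))))
        (trans (^-distribˡ-+-* 2 h i) (cong (p *_) 2^i≡))
      -- `2 ^ (k + k⁻) = p * suc k` supplies one spare `p`, and `2 ^ k = 2 * p` two more.
      ck+ : c * k + suc (2 ^ e) ≡ p * k + 3 * p
      ck+ = begin
        c * k + suc (2 ^ e)         ≡⟨ +-suc _ _ ⟩
        suc (c * k + 2 ^ e)         ≡⟨ cong (λ v → suc (v + 2 ^ e)) (trans (sym ck≡) prime⇒a≡) ⟩
        suc (value (k + k⁻) k e + 2 ^ e) ≡⟨ value-+ (k + k⁻) (m∸n≤m k i) ⟩
        2 ^ (k + k⁻) + 2 ^ k        ≡⟨ cong₂ _+_ 2^l≡ 2^k≡ ⟩
        p * suc k + 2 * p           ≡⟨ lem p k ⟩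
        p * k + 3 * p               ∎
        where
        open ≡-Reasoning
        lem : ∀ p k → p * (1 + k) + 2 * p ≡ p * k + 3 * p
        lem = solve-∀
      1+2^e≤3p : suc (2 ^ e) ≤ 3 * p
      1+2^e≤3p = begin
        1 + 2 ^ e   ≤⟨ +-mono-≤ (m^n>0 2 h) (^-monoʳ-≤ 2 (m∸n≤m k i)) ⟩
        p + 2 ^ k   ≡⟨ cong (p +_) 2^k≡ ⟩
        3 * p       ∎
        where open ≤-Reasoning
      p≤c : p ≤ c
      p≤c = *-cancelʳ-≤ p c k (+-cancelʳ-≤ (suc (2 ^ e)) _ _
        (≤-trans (+-monoʳ-≤ (p * k) 1+2^e≤3p) (≤-reflexive (sym ck+))))
      -- `p` is half of `2 ^ k`, so `d` is the excess of `c` over that half; `d * k` turns out to be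
      -- `3 * p - 1 - 2 ^ e`.
      d = c ∸ p
      p+d≡ : p + d ≡ c
      p+d≡ = m+[n∸m]≡n p≤c
      2c≡ : 2 * c ≡ 2 ^ k + 2 * d
      2c≡ = trans (cong (2 *_) (sym p+d≡)) (trans (*-distribˡ-+ 2 p d) (cong (_+ 2 * d) (sym 2^k≡)))
      dk+ : d * k + suc (2 ^ e) ≡ 3 * p
      dk+ = +-cancelˡ-≡ (p * k) _ _ (begin
        p * k + (d * k + suc (2 ^ e))  ≡⟨ lem p d k (suc (2 ^ e)) ⟩
        (p + d) * k + suc (2 ^ e)      ≡⟨ cong (λ v → v * k + suc (2 ^ e)) p+d≡ ⟩
        c * k + suc (2 ^ e)            ≡⟨ ck+ ⟩
        p * k + 3 * p                  ∎)
        where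
        open ≡-Reasoning
        lem : ∀ p d k s → p * k + (d * k + s) ≡ (p + d) * k + s
        lem = solve-∀
      dk< : d * k < 2 * 2 ^ k
      dk< = begin-strict
        d * k                   <⟨ m<m+n (d * k) (s≤s z≤n) ⟩
        d * k + suc (2 ^ e)     ≡⟨ dk+ ⟩
        3 * p                   ≤⟨ *-monoˡ-≤ p (n≤1+n 3) ⟩
        4 * p                   ≡⟨ *-assoc 2 2 p ⟩
        2 * (2 * p)             ≡⟨ cong (2 *_) 2^k≡ ⟨
        2 * 2 ^ k               ∎
        where open ≤-Reasoning

-- Unqualified only from here on, since +_ makes the sections of _+_ ambiguous.
open import Data.Integer.Base using (+_)

-- Convergence to one half along Mersenne primes

∣-½∣< : ∀ r x y .{{_ : NonZero y}} d (ε : ℚ) → r ≡ + x ℚ./ y → 2 * x ≡ y + 2 * d →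
         2 * d * ℚ.↧ₙ ε < y * 2 → 0ℚ ℚ.< ε → ℚ.∣ r ℚ.- ½ ∣ ℚ.< ε
∣-½∣< r x y@(suc y-1) d ε@(ℚ.mkℚ (+ suc n) q-1 _) refl 2x≡ bound _ = ℚ.toℚᵘ-cancel-< (begin-strict
  ℚ.toℚᵘ ℚ.∣ r ℚ.- ½ ∣               ≃⟨ ℚ.toℚᵘ-homo-∣-∣ (r ℚ.- ½) ⟩
  ℚᵘ.∣ ℚ.toℚᵘ (r ℚ.- ½) ∣            ≃⟨ ℚᵘ.∣-∣-cong (ℚ.toℚᵘ-homo-+ r (ℚ.- ½)) ⟩
  ℚᵘ.∣ ℚ.toℚᵘ r ℚᵘ.- ℚ.toℚᵘ ½ ∣      ≃⟨ ℚᵘ.∣-∣-cong (ℚᵘ.+-congˡ (ℚᵘ.- ℚ.toℚᵘ ½)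
                                          (ℚ.toℚᵘ-fromℚᵘ (mkℚᵘ (+ x) y-1))) ⟩
  ℚᵘ.∣ mkℚᵘ (+ x) y-1 ℚᵘ.- ℚ.toℚᵘ ½ ∣ <⟨ ℚᵘ.*<* goal ⟩
  ℚ.toℚᵘ ε                           ∎)
  where
  open ℚᵘ.≤-Reasoning
  -- Over the denominator `y * 2`, `x / y` minus one half has numerator `2 * x - y`, that is
  -- `2 * d`.
  num : (+ x) ℤ.* (+ 2) ℤ.+ (-[1+ 0 ]) ℤ.* (+ y) ≡ + (2 * d)
  num = trans (cong₂ ℤ._+_
      (trans (sym (ℤ.pos-* x 2)) (cong +_ (trans (*-comm x 2) (trans 2x≡ (+-comm y (2 * d))))))
      (ℤ.-1*i≡-i (+ y)))
    (trans (cong (ℤ._+ (ℤ.- + y)) (ℤ.pos-+ (2 * d) y))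
    (trans (ℤ.+-assoc (+ (2 * d)) (+ y) (ℤ.- + y))
    (trans (cong (λ z → + (2 * d) ℤ.+ z) (ℤ.+-inverseʳ (+ y))) (ℤ.+-identityʳ _))))
  goal : + ℤ.∣ (+ x) ℤ.* (+ 2) ℤ.+ (-[1+ 0 ]) ℤ.* (+ y) ∣ ℤ.* (+ suc q-1) ℤ.< (+ suc n) ℤ.* (+ (y * 2))
  goal = subst₂ ℤ._<_
    (trans (ℤ.pos-* (2 * d) (suc q-1)) (cong (λ z → + ℤ.∣ z ∣ ℤ.* + suc q-1) (sym num)))
    (ℤ.pos-* (suc n) (y * 2))
    -- The numerator `suc n` of `ε` is at least 1, so a bound against `1 / suc q-1` suffices.
    (ℤ.+<+ (<-≤-trans bound (m≤m+n (y * 2) (n * (y * 2)))))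
∣-½∣< r x y d (ℚ.mkℚ (+ 0) _ _) _ _ _ (ℚ.*<* (ℤ.+<+ ()))
∣-½∣< r x y d (ℚ.mkℚ -[1+ _ ] _ _) _ _ _ (ℚ.*<* ())

mersenne-exponent : ∀ i {k} → Prime k → k ≡ 2 ^ i ∸ 1 → 2 ≤ i
mersenne-exponent zero pk refl = contradiction (nonTrivial⇒n>1 0 {{prime⇒nonTrivial pk}}) λ ()
mersenne-exponent (suc zero) pk refl =
  contradiction (nonTrivial⇒n>1 1 {{prime⇒nonTrivial pk}}) λ { (s≤s ()) }
mersenne-exponent (suc (suc i)) pk k≡ = s≤s (s≤s z≤n)

-- The bounds place `x k / 2 ^ k` at distance `d / 2 ^ k < 2 / k` from one half. With `q` the
-- denominator of `ε`, the threshold `2 * q` gives `2 / k ≤ 1 / q ≤ ε`.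
tendsTo-½ : ∀ {S} (f : (k : ℕ) → .{{NonZero k}} → ℚ) (x : (k : ℕ) → .{{NonZero k}} → ℕ) →
            (∀ k .{{_ : NonZero k}} → f k ≡ ((+ x k) ℚ./ (2 ^ k)) {{m^n≢0 2 k}}) →
            (∀ k .{{_ : NonZero k}} → S k → ∃ λ d → 2 * x k ≡ 2 ^ k + 2 * d × d * k < 2 * 2 ^ k) →
            TendsToThrough S f ½
tendsTo-½ f x f≡ bounds ε 0<ε = 2 * q , λ k Sk 2q≤k →
  let d , 2x≡ , dk< = bounds k Sk
  in ∣-½∣< (f k) (x k) (2 ^ k) {{m^n≢0 2 k}} d ε (f≡ k) 2x≡ (2dq< k d 2q≤k dk<) 0<ε
  where
  q = ℚ.↧ₙ ε
  lem : ∀ d q → 2 * d * q ≡ d * (2 * q)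
  lem = solve-∀
  2dq< : ∀ k d → 2 * q ≤ k → d * k < 2 * 2 ^ k → 2 * d * q < 2 ^ k * 2
  2dq< k d 2q≤k dk< = begin-strict
    2 * d * q     ≡⟨ lem d q ⟩
    d * (2 * q)   ≤⟨ *-monoʳ-≤ d 2q≤k ⟩
    d * k         <⟨ dk< ⟩
    2 * 2 ^ k     ≡⟨ *-comm 2 (2 ^ k) ⟩
    2 ^ k * 2     ∎
    where open ≤-Reasoning

mersennePrime⇒c-bounds : ∀ k .{{_ : NonZero k}} → MersennePrime k →
                         ∃ λ d → 2 * c k ≡ 2 ^ k + 2 * d × d * k < 2 * 2 ^ k
mersennePrime⇒c-bounds k (pk , i , k≡) =
  LeastCandidate.prime⇒c-bounds 2≤i k≡ (a-least k) (negResidue-least i k) pk (c k) (_∣_.equality (k∣a k))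
  where
  2≤i = mersenne-exponent i pk k≡
  instance
    i≢0 : NonZero i
    i≢0 = >-nonZero (≤-trans (s≤s z≤n) 2≤i)

-- tendsTo-½ is stated for arbitrary f so that this conversion, costly because
-- it unfolds the gcd of c k and 2 ^ k, is checked only here.
c/2^≡ : ∀ k .{{_ : NonZero k}} → c/2^ k ≡ ((+ c k) ℚ./ (2 ^ k)) {{m^n≢0 2 k}}
c/2^≡ k = refl

mainTheorem7 : (∀ (i k : ℕ) .{{_ : NonZero i}} .{{_ : NonZero k}} → 2 ≤ i → k ≡ 2 ^ i ∸ 1 →
    let k⁻ = negResidue i k in
    (a k ≤ 2 ^ (k + k⁻) + 2 ^ k ∸ 2 ^ (k ∸ i) ∸ 1)
    × (Prime k →
    (k⁻ ≡ i ∸ 1)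
    × (a k ≡ 2 ^ (k + k⁻) + 2 ^ k ∸ 2 ^ (k ∸ i) ∸ 1)
    × (a k ≡ 2 ^ (k + i ∸ 1) + 2 ^ k ∸ 2 ^ (k ∸ i) ∸ 1)))
    × (Inf MersennePrime → TendsToThrough MersennePrime c/2^ ½)
mainTheorem7 =
  (λ i k 2≤i k≡ →
    let open LeastCandidate 2≤i k≡ (a-least k) (negResidue-least i k)
    in a-≤ , λ pk → prime⇒negResidue≡ pk , prime⇒a≡ pk , prime⇒a≡′ pk) ,
  λ _ → tendsTo-½ c/2^ c c/2^≡ mersennePrime⇒c-bounds
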